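{- The model-checking problem for A-HLTL is undecidable: there is no algorithm that, given a finite Kripke structure $\mathcal{K}$ and a closed A-HLTL formula $\varphi$, decides whether $\mathcal{K}\models\varphi$.
   Context: Let $\mathsf{AP}$ be a finite set of atomic propositions and $\Sigma=2^{\mathsf{AP}}$; traces are elements of $\Sigma^\omega$. A Kripke structure is $\mathcal{K}=\langle S,S_{\mathit{init}},\delta,L\rangle$ with initial states $S_{\mathit{init}}\subseteq S$, transition relation $\delta\subseteq S\times S$ where every state has a successor, and labeling $L:S\to\Sigma$; $\mathsf{Traces}(\mathcal{K})$ is the set of label sequences $L(s(0))L(s(1))\cdots$ of paths with $s(0)\in S_{\mathit{init}}$ and $(s(i),s(i+1))\in\delta$. A-HLTL syntax: $\varphi::=\exists\pi.\varphi\mid\forall\pi.\varphi\mid\mathsf{E}\psi\mid\mathsf{A}\psi$, $\psi::=a_\pi\mid\neg\psi\mid\psi\vee\psi\mid\psi\,\mathcal{U}\,\psi\mid\bigcirc\psi$ ($a\in\mathsf{AP}$, $\pi$ a trace variable), with usual abbreviations; a formula is closed if each atom $a_\pi$ has $\pi$ quantified and no variable is quantified twice. Semantics: trace assignments $\Pi$ map trace variables to pointed traces $(\sigma,p)$, $p\in\mathbb{N}$. A trajectory over $V$ is an infinite sequence $t=t(0)t(1)\cdots$ of nonempty subsets of $V$, fair if each $\pi\in V$ lies in infinitely many $t(j)$. $(\Pi,t)+1=(\Pi',t(1)t(2)\cdots)$, where $\Pi'(\pi)=(\sigma,p+1)$ if $\pi\in t(0)$ and $\Pi(\pi)=(\sigma,p)$,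 else $\Pi'(\pi)=\Pi(\pi)$; $(\Pi,t)+k$ iterates. Quantifiers $\exists\pi$/$\forall\pi$ bind $\pi$ to $(\sigma,0)$ for some/all $\sigma\in\mathsf{Traces}(\mathcal{K})$; $\Pi\models\mathsf{E}\psi$ (resp. $\mathsf{A}\psi$) iff $(\Pi,t)\models\psi$ for some (resp. all) fair trajectories $t$ over $\mathrm{Dom}(\Pi)$; $(\Pi,t)\models a_\pi$ iff $a\in\sigma(p)$ where $\Pi(\pi)=(\sigma,p)$; Booleans as usual; $(\Pi,t)\models\bigcirc\psi$ iff $(\Pi,t)+1\models\psi$; $(\Pi,t)\models\psi_1\mathcal{U}\psi_2$ iff for some $i\ge0$, $(\Pi,t)+i\models\psi_2$ and $(\Pi,t)+j\models\psi_1$ for all $j<i$. $\mathcal{K}\models\varphi$ iff the empty assignment satisfies $\varphi$. -}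

module Defs where

open import Data.Nat using (ℕ; zero; suc; _+_; _≤_; _<_)
open import Data.Fin using (Fin)
open import Data.Bool using (Bool; true; false; if_then_else_)
open import Data.List using (List; []; _∷_; length; lookup; concatMap)
open import Data.List.Relation.Unary.Any using (Any)
open import Data.List.Membership.Propositional using (_∈_; _∉_)
open import Data.Maybe using (Maybe; just; nothing)
open import Data.Product using (Σ; ∃; _×_; _,_; proj₁; proj₂)
open import Data.Sum using (_⊎_)
open import Data.Empty using (⊥)
open import Relation.Nullary using (¬_)
open import Relation.Binary.PropositionalEquality using (_≡_; _≢_)
open import Data.Nat using (_≟_)
open import Relation.Nullary using (yes; no)

-- Atomic propositions: AP = Fin k;  Σ = 2^AP = Fin k → Bool.

Var : Set
Var = ℕ

Letter : ℕ → Set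
Letter k = Fin k → Bool

Trace : ℕ → Set
Trace k = ℕ → Letter k

record Kripke (k : ℕ) : Set where
  field
    n     : ℕ
    init  : Fin n → Bool
    δ     : Fin n → Fin n → Bool
    L     : Fin n → Letter k
    total : ∀ s → ∃ λ s′ → δ s s′ ≡ true

IsTrace : ∀ {k} → Kripke k → Trace k → Set
IsTrace K σ =
  Σ (ℕ → Fin n) λ r →
    (init (r 0) ≡ true)
    × (∀ i → δ (r i) (r (suc i)) ≡ true)
    × (∀ i a → σ i a ≡ L (r i) a)
  where open Kripke K

infixr 5 _∨'_
infixr 6 _U_

data PathF (k : ℕ) : Set where
  atom  : Fin k → Var → PathF k
  ¬'_   : PathF k → PathF k
  _∨'_  : PathF k → PathF k → PathF k
  _U_   : PathF k → PathF k → PathF k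
  ○_    : PathF k → PathF k

data Formula (k : ℕ) : Set where
  ∃'  : Var → Formula k → Formula k
  ∀'  : Var → Formula k → Formula k
  E   : PathF k → Formula k
  A   : PathF k → Formula k

ClosedP : ∀ {k} → List Var → PathF k → Set
ClosedP bs (atom a π) = π ∈ bs
ClosedP bs (¬' ψ)     = ClosedP bs ψ
ClosedP bs (ψ ∨' χ)   = ClosedP bs ψ × ClosedP bs χ
ClosedP bs (ψ U χ)    = ClosedP bs ψ × ClosedP bs χ
ClosedP bs (○ ψ)      = ClosedP bs ψ

ClosedF : ∀ {k} → List Var → Formula k → Set
ClosedF bs (∃' π φ) = π ∉ bs × ClosedF (π ∷ bs) φ
ClosedF bs (∀' π φ) = π ∉ bs × ClosedF (π ∷ bs) φ
ClosedF bs (E ψ)    = ClosedP bs ψ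
ClosedF bs (A ψ)    = ClosedP bs ψ

Closed : ∀ {k} → Formula k → Set
Closed = ClosedF []

-- trace assignment (variables bound so far, each to a trace; all pointed at 0
-- when a trajectory starts, since E/A occur only after the quantifier prefix)
Assignment : ℕ → Set
Assignment k = List (Var × Trace k)

lookupVar : ∀ {k} → Assignment k → Var → Maybe (Trace k)
lookupVar []              π = nothing
lookupVar ((x , σ) ∷ Π)   π with x ≟ π
... | yes _ = just σ
... | no  _ = lookupVar Π π

InDom : ∀ {k} → Assignment k → Var → Set
InDom Π π = Any (λ p → proj₁ p ≡ π) Π

Trajectory : Set
Trajectory = ℕ → Var → Bool

IsTrajectory : ∀ {k} → Assignment k → Trajectory → Set
IsTrajectory Π t =
  (∀ j π → t j π ≡ true → InDom Π π)
  × (∀ j → ∃ λ π → t j π ≡ true)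

Fair : ∀ {k} → Assignment k → Trajectory → Set
Fair Π t = ∀ π → InDom Π π → ∀ i → ∃ λ j → i ≤ j × t j π ≡ true

-- number of j < i with π ∈ t(j): the position of π in (Π,t)+i
count : Trajectory → Var → ℕ → ℕ
count t π zero    = 0
count t π (suc i) = count t π i + (if t i π then 1 else 0)

atomHolds : ∀ {k} → Maybe (Trace k) → ℕ → Fin k → Set
atomHolds nothing  p a = ⊥
atomHolds (just σ) p a = σ p a ≡ true

-- sat Π t i ψ  ⟺  (Π,t)+i ⊨ ψ   (Π with all pointers at 0)
sat : ∀ {k} → Assignment k → Trajectory → ℕ → PathF k → Set
sat Π t i (atom a π) = atomHolds (lookupVar Π π) (count t π i) a
sat Π t i (¬' ψ)     = ¬ sat Π t i ψ
sat Π t i (ψ ∨' χ)   = sat Π t i ψ ⊎ sat Π t i χ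
sat Π t i (ψ U χ)    =
  ∃ λ m → sat Π t (i + m) χ × (∀ j → j < m → sat Π t (i + j) ψ)
sat Π t i (○ ψ)      = sat Π t (suc i) ψ

models : ∀ {k} → Kripke k → Assignment k → Formula k → Set
models K Π (∃' π φ) = Σ (Trace _) λ σ → IsTrace K σ × models K ((π , σ) ∷ Π) φ
models K Π (∀' π φ) = (σ : Trace _) → IsTrace K σ → models K ((π , σ) ∷ Π) φ
models K Π (E ψ)    = Σ Trajectory λ t → IsTrajectory Π t × Fair Π t × sat Π t 0 ψ
models K Π (A ψ)    = (t : Trajectory) → IsTrajectory Π t → Fair Π t → sat Π t 0 ψ

infix 4 _⊨_
_⊨_ : ∀ {k} → Kripke k → Formula k → Set
K ⊨ φ = models K [] φ

Tile : Set
Tile = List Bool × List Bool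

PCPSolvable : List Tile → Set
PCPSolvable P =
  Σ (List (Fin (length P))) λ is →
    (is ≢ [])
    × (concatMap (λ i → proj₁ (lookup P i)) is ≡ concatMap (λ i → proj₂ (lookup P i)) is)

-- Reduction from Post's correspondence problem. A tile (u , v) is written as the word of its
-- top bits u followed by its bottom bits v. The Kripke structure of an instance P generates the
-- traces reading the concatenated words of tile sequences, then end letters forever; each letter
-- also carries the parities of the numbers of top and of bottom symbols read before it. The
-- formula ∃x ∀y E (differs ∨ aligns) says: every y either differs from x, shown by a trajectory
-- keeping the parities of x and y equal until a letter differs, or y = x and a trajectory walks
-- x through the top symbols and y through the bottom symbols in lockstep with matching bits.
-- Since counters moving in unit steps from 0 are determined by their parities, equal parities
-- mean equal counts: for y = x the first alternative is impossible and the second says that the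
-- tops of x equal its bottoms, a solution. Conversely, if x reads a solution, each y either
-- differs from x, detected synchronously, or agrees with x, and then the lockstep alignment of
-- the solution's tops with its bottoms is the required trajectory. Tiles with an empty word are
-- solutions by themselves.

module Submission where

open import Defs
open import Data.Nat using (ℕ; zero; suc; _+_; _∸_; _≤_; _<_; z≤n; s≤s)
open import Data.Nat.Properties
open import Data.Bool using (Bool; true; false; not; _∧_; _∨_; _xor_; if_then_else_)
import Data.Bool.Properties as Bool
open import Data.Fin using (Fin) renaming (zero to fzero; suc to fsuc)
open import Data.Fin.Properties using (any?)
import Data.Fin.Properties as Fin
open import Data.List using (List; []; _∷_; _++_; length; map; concatMap; lookup; upTo; allFin; fromMaybe; head; drop; take; mapMaybe)
open import Data.List.Properties using (drop-[]; take-all; mapMaybe-++)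
open import Data.List.Membership.Propositional using (_∈_)
open import Data.List.Membership.Propositional.Properties using (∈-++⁺ˡ; ∈-++⁺ʳ; ∈-map⁺; ∈-upTo⁺; ∈-concatMap⁺; ∈-allFin)
open import Data.List.Relation.Unary.Any using (here; there; index)
import Data.List.Relation.Unary.Any as Any
open import Data.List.Relation.Unary.Any.Properties using (lookup-index)
open import Data.Maybe using (Maybe; just; nothing; is-just; _>>=_)
open import Data.Maybe.Properties using (just-injective)
open import Data.Product using (Σ; ∃; ∃₂; _×_; _,_; proj₁; proj₂; uncurry)
open import Data.Product.Properties using () renaming (≡-dec to ×-≡-dec)
open import Data.Sum using (_⊎_; inj₁; inj₂; [_,_]′)
open import Data.Sum.Properties using () renaming (≡-dec to ⊎-≡-dec)
open import Data.Unit using (⊤; tt)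
open import Data.Vec using (_∷_; [])
import Data.Vec as Vec
open import Data.Empty using (⊥; ⊥-elim)
open import Function using (_∘_; _∘′_; _$_)
open import Function.Bundles using (_⇔_; mk⇔)
open import Relation.Nullary using (¬_; Dec; yes; no; does)
open import Relation.Nullary.Decidable using (dec-true)
import Relation.Nullary.Decidable as Dec
open import Relation.Nullary.Reflects using (Reflects; ofʸ; ofⁿ; ¬-reflects; _⊎-reflects_; det; invert)
open import Relation.Unary using (Decidable)
open import Relation.Binary using (DecidableEquality)
open import Relation.Binary.PropositionalEquality

bit : Bool → ℕ
bit b = if b then 1 else 0

countTrue : (ℕ → Bool) → ℕ → ℕ
countTrue f zero    = 0
countTrue f (suc n) = countTrue f n + bit (f n)

parity : ℕ → Bool
parity zero    = false
parity (suc n) = not (parity n)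

UnitSteps : (ℕ → ℕ) → Set
UnitSteps f = ∀ j → f (suc j) ≡ f j ⊎ f (suc j) ≡ suc (f j)

+bit-unitStep : ∀ n b → n + bit b ≡ n ⊎ n + bit b ≡ suc n
+bit-unitStep n true  = inj₂ (+-comm n 1)
+bit-unitStep n false = inj₁ (+-identityʳ n)

parity-+bit : ∀ n b → parity (n + bit b) ≡ b xor parity n
parity-+bit n true  rewrite +-comm n 1 = refl
parity-+bit n false rewrite +-identityʳ n = refl

countTrue-unitSteps : ∀ f → UnitSteps (countTrue f)
countTrue-unitSteps f j = +bit-unitStep (countTrue f j) (f j)

count-unitSteps : ∀ t π → UnitSteps (count t π)
count-unitSteps t π j = +bit-unitStep (count t π j) (t j π)

unitSteps-∘ : ∀ {f g} → UnitSteps f → UnitSteps g → UnitSteps (λ j → g (f j))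
unitSteps-∘ {f} sf sg j with sf j
... | inj₁ e rewrite e = inj₁ refl
... | inj₂ e rewrite e = sg (f j)

parity-suc≢ : ∀ n → parity (suc n) ≢ parity n
parity-suc≢ n e with parity n
parity-suc≢ n () | true
parity-suc≢ n () | false

unitSteps-parity⇒≡ : ∀ {f g} → UnitSteps f → UnitSteps g → f 0 ≡ 0 → g 0 ≡ 0 → ∀ m →
                     (∀ j → j ≤ m → parity (f j) ≡ parity (g j)) → ∀ j → j ≤ m → f j ≡ g j
unitSteps-parity⇒≡ sf sg f0 g0 m same zero _ = trans f0 (sym g0)
unitSteps-parity⇒≡ {f} {g} sf sg f0 g0 m same (suc j) sj≤m
  with unitSteps-parity⇒≡ sf sg f0 g0 m same j (≤-trans (n≤1+n j) sj≤m) | sf j | sg j | same (suc j) sj≤m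
... | e | inj₁ a | inj₁ b | _  = trans a (trans e (sym b))
... | e | inj₂ a | inj₂ b | _  = trans a (trans (cong suc e) (sym b))
... | e | inj₁ a | inj₂ b | pe rewrite a | b | e = ⊥-elim (parity-suc≢ (g j) (sym pe))
... | e | inj₂ a | inj₁ b | pe rewrite a | b | e = ⊥-elim (parity-suc≢ (g j) pe)

unitSteps-crossing : ∀ {f} → UnitSteps f → f 0 ≡ 0 → ∀ m k → k < f m →
                     ∃ λ e → e < m × f e ≡ k × f (suc e) ≡ suc k
unitSteps-crossing {f} sf f0 zero k k<f rewrite f0 = ⊥-elim (n≮0 k<f)
unitSteps-crossing {f} sf f0 (suc m) k k<f with k <? f m
... | yes k<fm = let (e , e<m , a , b) = unitSteps-crossing sf f0 m k k<fm in e , m<n⇒m<1+n e<m , a , b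
... | no k≮fm with sf m
...   | inj₁ a = ⊥-elim (k≮fm (subst (k <_) a k<f))
...   | inj₂ a = m , n<1+n m , sym k≡fm , trans a (cong suc (sym k≡fm))
  where k≡fm = ≤-antisym (≤-pred (subst (k <_) a k<f)) (≮⇒≥ k≮fm)

countTrue-suc-true : ∀ f p → f p ≡ true → countTrue f (suc p) ≡ suc (countTrue f p)
countTrue-suc-true f p h rewrite h = +-comm (countTrue f p) 1

countTrue-suc⇒true : ∀ f p → countTrue f (suc p) ≡ suc (countTrue f p) → f p ≡ true
countTrue-suc⇒true f p h with f p
... | true  = refl
... | false = ⊥-elim (1+n≢n (sym (trans (sym (+-identityʳ (countTrue f p))) h)))

countTrue-mono : ∀ f {p q} → p ≤ q → countTrue f p ≤ countTrue f q
countTrue-mono f {q = zero}  z≤n = ≤-refl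
countTrue-mono f {q = suc q} p≤q with m≤n⇒m<n∨m≡n p≤q
... | inj₂ refl      = ≤-refl
... | inj₁ (s≤s p≤q) = ≤-trans (countTrue-mono f p≤q) (m≤m+n _ _)

countTrue-strict : ∀ f {p q} → f p ≡ true → p < q → countTrue f p < countTrue f q
countTrue-strict f {p} h p<q = ≤-trans (≤-reflexive (sym (countTrue-suc-true f p h))) (countTrue-mono f p<q)

countTrue-cong : ∀ {f g} j → (∀ q → q < j → f q ≡ g q) → countTrue f j ≡ countTrue g j
countTrue-cong zero    h = refl
countTrue-cong (suc j) h = cong₂ _+_ (countTrue-cong j (λ q lt → h q (m<n⇒m<1+n lt))) (cong bit (h j (n<1+n j)))

countTrue-true : ∀ n → countTrue (λ _ → true) n ≡ n
countTrue-true zero    = refl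
countTrue-true (suc n) = trans (cong (_+ 1) (countTrue-true n)) (+-comm n 1)

first-false : (f : ℕ → Bool) (n : ℕ) →
              (∀ j → j < n → f j ≡ true) ⊎ (∃ λ j → f j ≡ false × (∀ j′ → j′ < j → f j′ ≡ true))
first-false f zero = inj₁ (λ j ())
first-false f (suc n) with first-false f n
... | inj₂ found = inj₂ found
... | inj₁ below with f n in e
...   | true  = inj₁ λ j lt → [ below j , (λ { refl → e }) ]′ (m<1+n⇒m<n∨m≡n lt)
...   | false = inj₂ (n , e , below)

countTrue-along-parity⇒≡ : ∀ (t : Trajectory) π π′ h h′ m →
  (∀ j → j ≤ m → parity (countTrue h (count t π j)) ≡ parity (countTrue h′ (count t π′ j))) →
  ∀ j → j ≤ m → countTrue h (count t π j) ≡ countTrue h′ (count t π′ j)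
countTrue-along-parity⇒≡ t π π′ h h′ m =
  unitSteps-parity⇒≡ (unitSteps-∘ (count-unitSteps t π) (countTrue-unitSteps h))
                     (unitSteps-∘ (count-unitSteps t π′) (countTrue-unitSteps h′)) refl refl m

countTrue-crossing : ∀ h {c} → UnitSteps c → ∀ e → countTrue h (c (suc e)) ≡ suc (countTrue h (c e)) → h (c e) ≡ true
countTrue-crossing h {c} c-steps e up with c-steps e
... | inj₁ same = ⊥-elim (1+n≢n (sym (trans (cong (countTrue h) (sym same)) up)))
... | inj₂ next = countTrue-suc⇒true h (c e) (trans (cong (countTrue h) (sym next)) up)

infixl 9 _!?_
_!?_ : ∀ {A : Set} → List A → ℕ → Maybe A
[]       !? _     = nothing
(a ∷ as) !? zero  = just a
(a ∷ as) !? suc n = as !? n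

!?-just⇒< : ∀ {A : Set} (xs : List A) n {x} → xs !? n ≡ just x → n < length xs
!?-just⇒< (_ ∷ xs) zero    _ = s≤s z≤n
!?-just⇒< (_ ∷ xs) (suc n) e = s≤s (!?-just⇒< xs n e)

!?-nothing⇒≥ : ∀ {A : Set} (xs : List A) n → xs !? n ≡ nothing → length xs ≤ n
!?-nothing⇒≥ []       n       _ = z≤n
!?-nothing⇒≥ (_ ∷ xs) (suc n) e = s≤s (!?-nothing⇒≥ xs n e)

!?-≥length : ∀ {A : Set} (xs : List A) n → length xs ≤ n → xs !? n ≡ nothing
!?-≥length []       n       _         = refl
!?-≥length (_ ∷ xs) (suc n) (s≤s len≤n) = !?-≥length xs n len≤n

!?-ext : ∀ {A : Set} (xs ys : List A) → (∀ n → xs !? n ≡ ys !? n) → xs ≡ ys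
!?-ext []       []       _  = refl
!?-ext []       (_ ∷ _)  eq with () ← eq 0
!?-ext (_ ∷ _)  []       eq with () ← eq 0
!?-ext (a ∷ as) (b ∷ bs) eq with refl ← eq 0 = cong (a ∷_) (!?-ext as bs (λ n → eq (suc n)))

lookupOr : ∀ {A : Set} → A → List A → ℕ → A
lookupOr d []       _       = d
lookupOr d (s ∷ ss) zero    = s
lookupOr d (s ∷ ss) (suc j) = lookupOr d ss j

drop-lookupOr : ∀ {A : Set} (d : A) (ss : List A) j → j < length ss → drop j ss ≡ lookupOr d ss j ∷ drop (suc j) ss
drop-lookupOr d (s ∷ ss) zero    _         = refl
drop-lookupOr d (s ∷ ss) (suc j) (s≤s j<n) = drop-lookupOr d ss j j<n

drop-≥length : ∀ {A : Set} (xs : List A) j → ¬ (j < length xs) → drop j xs ≡ []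
drop-≥length []       j       _   = drop-[] j
drop-≥length (a ∷ as) zero    j≮n = ⊥-elim (j≮n (s≤s z≤n))
drop-≥length (a ∷ as) (suc j) j≮n = drop-≥length as j (j≮n ∘′ s≤s)

bools : List Bool
bools = true ∷ false ∷ []

∈-bools : ∀ b → b ∈ bools
∈-bools true  = here refl
∈-bools false = there (here refl)

∈-concatMap⁺′ : ∀ {A B : Set} (f : A → List B) {x y xs} → x ∈ xs → y ∈ f x → y ∈ concatMap f xs
∈-concatMap⁺′ f x∈ y∈ = ∈-concatMap⁺ f (Any.map (λ { refl → y∈ }) x∈)

module _ {A B : Set} (f : A → Maybe B) where

  selectedBefore : List A → ℕ → ℕ
  selectedBefore W p = length (mapMaybe f (take p W))

  selectedBefore-suc : ∀ W p → selectedBefore W (suc p) ≡ selectedBefore W p + bit (is-just (W !? p >>= f))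
  selectedBefore-suc []      zero    = refl
  selectedBefore-suc []      (suc p) = refl
  selectedBefore-suc (a ∷ W) zero    with f a
  ... | just _  = refl
  ... | nothing = refl
  selectedBefore-suc (a ∷ W) (suc p) with f a
  ... | just _  = cong suc (selectedBefore-suc W p)
  ... | nothing = selectedBefore-suc W p

  selected-!? : ∀ W p {a b} → W !? p ≡ just a → f a ≡ just b → mapMaybe f W !? selectedBefore W p ≡ just b
  selected-!? (s ∷ W) zero    refl fa with f s
  selected-!? (s ∷ W) zero    refl refl | just _ = refl
  selected-!? (s ∷ W) (suc p) Wp   fa with f s
  ... | just _  = selected-!? W p Wp fa
  ... | nothing = selected-!? W p Wp fa

  selectedBefore-< : ∀ W p {a b} → W !? p ≡ just a → f a ≡ just b → selectedBefore W p < length (mapMaybe f W)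
  selectedBefore-< W p Wp fa = !?-just⇒< (mapMaybe f W) _ (selected-!? W p Wp fa)

  selectedBefore-all : ∀ W p → length W ≤ p → selectedBefore W p ≡ length (mapMaybe f W)
  selectedBefore-all W p len≤p = cong (length ∘ mapMaybe f) (take-all p W len≤p)

  selectedBefore-+bit : ∀ W p b → selectedBefore W (p + bit b) ≡ selectedBefore W p + bit (b ∧ is-just (W !? p >>= f))
  selectedBefore-+bit W p true  rewrite +-comm p 1 = selectedBefore-suc W p
  selectedBefore-+bit W p false rewrite +-identityʳ p = sym (+-identityʳ _)

_⇔ᵇ_ : Bool → Bool → Bool
a ⇔ᵇ b = (a ∧ b) ∨ (not a ∧ not b)

∧≡true⁻ : ∀ {a b} → a ∧ b ≡ true → a ≡ true × b ≡ true
∧≡true⁻ {true} {true} _ = refl , refl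

⇔ᵇ≡true⁻ : ∀ {a b} → a ⇔ᵇ b ≡ true → a ≡ b
⇔ᵇ≡true⁻ {true}  {true}  _ = refl
⇔ᵇ≡true⁻ {false} {false} _ = refl

⇔ᵇ-refl : ∀ a → a ⇔ᵇ a ≡ true
⇔ᵇ-refl true  = refl
⇔ᵇ-refl false = refl

⇒ᵇ-mp : ∀ {a b c} → not (a ∧ b) ∨ c ≡ true → a ≡ true → b ≡ true → c ≡ true
⇒ᵇ-mp {true} {true} c refl refl = c

⇔ᵇ-≡ : ∀ {a b} → a ≡ b → a ⇔ᵇ b ≡ true
⇔ᵇ-≡ {a} refl = ⇔ᵇ-refl a

⇒ᵇ-intro : ∀ {a b c} → (a ≡ true → b ≡ true → c ≡ true) → not (a ∧ b) ∨ c ≡ true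
⇒ᵇ-intro {true}  {true}  c = c refl refl
⇒ᵇ-intro {true}  {false} c = refl
⇒ᵇ-intro {false}         c = refl

data TraceVar : Set where
  x y : TraceVar

var : TraceVar → Var
var x = 0
var y = 1

infixr 5 _∨ᶠ_ _⇒ᶠ_
infixr 6 _∧ᶠ_
infix  4 _⇔ᶠ_

data StateFormula : Set where
  atᶠ   : Fin 5 → TraceVar → StateFormula
  ¬ᶠ_   : StateFormula → StateFormula
  _∨ᶠ_  : StateFormula → StateFormula → StateFormula
  _∧ᶠ_  : StateFormula → StateFormula → StateFormula

_⇒ᶠ_ _⇔ᶠ_ : StateFormula → StateFormula → StateFormula
φ ⇒ᶠ ψ = ¬ᶠ φ ∨ᶠ ψ
φ ⇔ᶠ ψ = (φ ∧ᶠ ψ) ∨ᶠ (¬ᶠ φ ∧ᶠ ¬ᶠ ψ)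

toPath : StateFormula → PathF 5
toPath (atᶠ a v) = atom a (var v)
toPath (¬ᶠ φ)    = ¬' toPath φ
toPath (φ ∨ᶠ ψ)  = toPath φ ∨' toPath ψ
toPath (φ ∧ᶠ ψ)  = ¬' (¬' toPath φ ∨' ¬' toPath ψ)

toPath-closed : ∀ φ → ClosedP (var y ∷ var x ∷ []) (toPath φ)
toPath-closed (atᶠ a x) = there (here refl)
toPath-closed (atᶠ a y) = here refl
toPath-closed (¬ᶠ φ)    = toPath-closed φ
toPath-closed (φ ∨ᶠ ψ)  = toPath-closed φ , toPath-closed ψ
toPath-closed (φ ∧ᶠ ψ)  = toPath-closed φ , toPath-closed ψ

≡true-reflects : ∀ b → Reflects (b ≡ true) b
≡true-reflects true  = ofʸ refl
≡true-reflects false = ofⁿ λ ()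

¬∨¬-reflects : ∀ {A B : Set} {a b} → Reflects A a → Reflects B b → Reflects (¬ ((¬ A) ⊎ (¬ B))) (a ∧ b)
¬∨¬-reflects (ofʸ p) (ofʸ q) = ofʸ [ _$ p , _$ q ]′
¬∨¬-reflects (ofʸ p) (ofⁿ ¬q) = ofⁿ λ k → k (inj₂ ¬q)
¬∨¬-reflects (ofⁿ ¬p) _       = ofⁿ λ k → k (inj₁ ¬p)

module Evaluation (σx σy : Trace 5) where

  Πxy : Assignment 5
  Πxy = (var y , σy) ∷ (var x , σx) ∷ []

  holdsAt : ℕ → ℕ → StateFormula → Bool
  holdsAt px py (atᶠ a x) = σx px a
  holdsAt px py (atᶠ a y) = σy py a
  holdsAt px py (¬ᶠ φ)    = not (holdsAt px py φ)
  holdsAt px py (φ ∨ᶠ ψ)  = holdsAt px py φ ∨ holdsAt px py ψ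
  holdsAt px py (φ ∧ᶠ ψ)  = holdsAt px py φ ∧ holdsAt px py ψ

  holds : Trajectory → ℕ → StateFormula → Bool
  holds t i = holdsAt (count t (var x) i) (count t (var y) i)

  holds-reflects : ∀ t i φ → Reflects (sat Πxy t i (toPath φ)) (holds t i φ)
  holds-reflects t i (atᶠ a x) = ≡true-reflects _
  holds-reflects t i (atᶠ a y) = ≡true-reflects _
  holds-reflects t i (¬ᶠ φ)    = ¬-reflects (holds-reflects t i φ)
  holds-reflects t i (φ ∨ᶠ ψ)  = holds-reflects t i φ ⊎-reflects holds-reflects t i ψ
  holds-reflects t i (φ ∧ᶠ ψ)  = ¬∨¬-reflects (holds-reflects t i φ) (holds-reflects t i ψ)

  sat⇒holds : ∀ t i φ → sat Πxy t i (toPath φ) → holds t i φ ≡ true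
  sat⇒holds t i φ s = det (holds-reflects t i φ) (ofʸ s)

  holds⇒sat : ∀ t i φ → holds t i φ ≡ true → sat Πxy t i (toPath φ)
  holds⇒sat t i φ h = invert (subst (Reflects _) h (holds-reflects t i φ))

does⇒witness : ∀ {A : Set} (a? : Dec A) → does a? ≡ true → A
does⇒witness (yes a) _ = a

module Enumerated {k} {State : Set} (states : List State)
  (Initial : State → Set) (initial? : Decidable Initial)
  (Step : State → State → Set) (step? : ∀ s s′ → Dec (Step s s′))
  (label : State → Letter k)
  (successor : State → State) (step-successor : ∀ s → Step s (successor s))
  (successor-∈ : ∀ s → successor s ∈ states) where

  private
    state : Fin (length states) → State
    state = lookup states

  kripke : Kripke k
  kripke = record
    { n     = length states
    ; init  = λ f → does (initial? (state f))
    ; δ     = λ f g → does (step? (state f) (state g))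
    ; L     = λ f → label (state f)
    ; total = λ f → let s′∈ = successor-∈ (state f) in
                    index s′∈ , dec-true (step? _ _) (subst (Step (state f)) (lookup-index s′∈) (step-successor (state f)))
    }

  record Run (σ : Trace k) : Set where
    field
      at       : ℕ → State
      initial  : Initial (at 0)
      step     : ∀ i → Step (at i) (at (suc i))
      labelled : ∀ i a → σ i a ≡ label (at i) a

  trace⇒run : ∀ {σ} → IsTrace kripke σ → Run σ
  trace⇒run (r , r0 , rs , rl) = record
    { at       = λ i → state (r i)
    ; initial  = does⇒witness (initial? _) r0
    ; step     = λ i → does⇒witness (step? _ _) (rs i)
    ; labelled = rl
    }

  run⇒trace : ∀ {σ} (ρ : Run σ) → (∀ i → Run.at ρ i ∈ states) → IsTrace kripke σ
  run⇒trace ρ listed =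
      (λ i → index (listed i))
    , dec-true (initial? _) (subst Initial (lookup-index (listed 0)) initial)
    , (λ i → dec-true (step? _ _) (subst₂ Step (lookup-index (listed i)) (lookup-index (listed (suc i))) (step i)))
    , λ i a → trans (labelled i a) (cong (λ s → label s a) (lookup-index (listed i)))
    where open Run ρ

data Symbol : Set where
  top bot : Bool → Symbol

isTop : Symbol → Bool
isTop (top _) = true
isTop (bot _) = false

value : Symbol → Bool
value (top b) = b
value (bot b) = b

tileWord : Tile → List Symbol
tileWord (u , v) = map top u ++ map bot v

-- The five atomic propositions: end of the word, top symbol, its bit, and the
-- parities of the numbers of top and of bottom symbols read before.
endₐ topₐ bitₐ ptₐ pbₐ : Fin 5
endₐ = fzero
topₐ = fsuc fzero
bitₐ = fsuc (fsuc fzero)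
ptₐ  = fsuc (fsuc (fsuc fzero))
pbₐ  = fsuc (fsuc (fsuc (fsuc fzero)))

letter : Bool → Bool → Bool → Bool → Bool → Letter 5
letter e t b pt pb = Vec.lookup (e ∷ t ∷ b ∷ pt ∷ pb ∷ [])

decode : Letter 5 → Maybe Symbol
decode ℓ = if ℓ topₐ then just (top (ℓ bitₐ)) else if ℓ endₐ then nothing else just (bot (ℓ bitₐ))

isBottom : Letter 5 → Bool
isBottom ℓ = not (ℓ endₐ) ∧ not (ℓ topₐ)

decode-cong : ∀ {ℓ ℓ′} → (∀ a → ℓ a ≡ ℓ′ a) → decode ℓ ≡ decode ℓ′
decode-cong {ℓ} {ℓ′} ℓ≗ℓ′ rewrite ℓ≗ℓ′ topₐ | ℓ≗ℓ′ endₐ | ℓ≗ℓ′ bitₐ = refl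

-- Past the end of W, σ carries only end letters.
Spells : List Symbol → Trace 5 → Set
Spells W σ = ∀ n → W !? n ≡ decode (σ n)

topBit botBit : Symbol → Maybe Bool
topBit (top b) = just b
topBit (bot _) = nothing
botBit (top _) = nothing
botBit (bot b) = just b

tops bots : List Symbol → List Bool
tops = mapMaybe topBit
bots = mapMaybe botBit

tops-tileWord : ∀ t → tops (tileWord t) ≡ proj₁ t
tops-tileWord ([] , [])    = refl
tops-tileWord ([] , _ ∷ v) = tops-tileWord ([] , v)
tops-tileWord (b ∷ u , v)  = cong (b ∷_) (tops-tileWord (u , v))

bots-tileWord : ∀ t → bots (tileWord t) ≡ proj₂ t
bots-tileWord ([] , [])    = refl
bots-tileWord ([] , b ∷ v) = cong (b ∷_) (bots-tileWord ([] , v))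
bots-tileWord (_ ∷ u , v)  = bots-tileWord (u , v)

mapMaybe-concatMap-tileWord : ∀ {C : Set} (sel : Symbol → Maybe Bool) (side : Tile → List Bool) →
                              (∀ t → mapMaybe sel (tileWord t) ≡ side t) →
                              ∀ (tile : C → Tile) I → mapMaybe sel (concatMap (tileWord ∘ tile) I) ≡ concatMap (side ∘ tile) I
mapMaybe-concatMap-tileWord sel side sel-tile tile []      = refl
mapMaybe-concatMap-tileWord sel side sel-tile tile (i ∷ I) =
  trans (mapMaybe-++ sel (tileWord (tile i)) _) (cong₂ _++_ (sel-tile (tile i)) (mapMaybe-concatMap-tileWord sel side sel-tile tile I))

topₐ-selects : ∀ ℓ → ℓ topₐ ≡ is-just (decode ℓ >>= topBit)
topₐ-selects ℓ with ℓ topₐ | ℓ endₐ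
... | true  | _     = refl
... | false | true  = refl
... | false | false = refl

isBottom-selects : ∀ ℓ → isBottom ℓ ≡ is-just (decode ℓ >>= botBit)
isBottom-selects ℓ with ℓ endₐ | ℓ topₐ
... | true  | true  = refl
... | true  | false = refl
... | false | true  = refl
... | false | false = refl

decode-top : ∀ ℓ → ℓ topₐ ≡ true → decode ℓ ≡ just (top (ℓ bitₐ))
decode-top ℓ reads-top rewrite reads-top = refl

decode-bottom : ∀ ℓ → isBottom ℓ ≡ true → decode ℓ ≡ just (bot (ℓ bitₐ))
decode-bottom ℓ reads-bottom with ℓ endₐ | ℓ topₐ
decode-bottom ℓ refl | false | false = refl

decode-nothing : ∀ ℓ → decode ℓ ≡ nothing → ℓ endₐ ≡ true
decode-nothing ℓ no-symbol with ℓ topₐ | ℓ endₐ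
decode-nothing ℓ refl | false | true = refl

countTrue-spells : ∀ {B : Set} (f : Symbol → Maybe B) {W σ} (g : Letter 5 → Bool) → Spells W σ →
                   (∀ ℓ → g ℓ ≡ is-just (decode ℓ >>= f)) →
                   ∀ p → countTrue (λ q → g (σ q)) p ≡ selectedBefore f W p
countTrue-spells f g spells g-spec zero    = refl
countTrue-spells f {W} {σ} g spells g-spec (suc p) = begin
  countTrue (λ q → g (σ q)) p + bit (g (σ p))  ≡⟨ cong₂ _+_ (countTrue-spells f g spells g-spec p) (cong bit (g-spec (σ p))) ⟩
  selectedBefore f W p + bit (is-just (decode (σ p) >>= f)) ≡⟨ cong (λ m → selectedBefore f W p + bit (is-just (m >>= f))) (sym (spells p)) ⟩
  selectedBefore f W p + bit (is-just (W !? p >>= f))       ≡⟨ sym (selectedBefore-suc f W p) ⟩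
  selectedBefore f W (suc p)                                ∎
  where open ≡-Reasoning

spells-top : ∀ {W σ} → Spells W σ → ∀ p → σ p topₐ ≡ true → tops W !? selectedBefore topBit W p ≡ just (σ p bitₐ)
spells-top {W} {σ} spells p reads-top = selected-!? topBit W p (trans (spells p) (decode-top (σ p) reads-top)) refl

spells-bottom : ∀ {W σ} → Spells W σ → ∀ p → isBottom (σ p) ≡ true → bots W !? selectedBefore botBit W p ≡ just (σ p bitₐ)
spells-bottom {W} {σ} spells p reads-bottom = selected-!? botBit W p (trans (spells p) (decode-bottom (σ p) reads-bottom)) refl

-- The Kripke structure of a PCP instance

module PCPKripke (P : List Tile) where

  p : ℕ
  p = length P

  word : Fin p → List Symbol
  word i = tileWord (lookup P i)

  len : Fin p → ℕ
  len i = length (word i)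

  -- Out-of-range positions read as a bottom 0; such states are never reached.
  symbolAt : Fin p → ℕ → Symbol
  symbolAt i = lookupOr (bot false) (word i)

  -- Reading position j of the word of tile i, or past the end of the whole word,
  -- together with the parities of top and bottom symbols read so far.
  State : Set
  State = (Fin p × ℕ × Bool × Bool) ⊎ (Bool × Bool)

  pattern reading i j pt pb = inj₁ (i , j , pt , pb)
  pattern finished pt pb    = inj₂ (pt , pb)

  _≟ˢ_ : DecidableEquality State
  _≟ˢ_ = ⊎-≡-dec (×-≡-dec Fin._≟_ (×-≡-dec _≟_ (×-≡-dec Bool._≟_ Bool._≟_))) (×-≡-dec Bool._≟_ Bool._≟_)

  currentSymbol : State → Maybe Symbol
  currentSymbol (reading i j _ _) = just (symbolAt i j)
  currentSymbol (finished _ _)    = nothing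

  topParity botParity : State → Bool
  topParity (reading _ _ pt _) = pt
  topParity (finished pt _)    = pt
  botParity (reading _ _ _ pb) = pb
  botParity (finished _ pb)    = pb

  label : State → Letter 5
  label (reading i j pt pb)   = letter false (isTop (symbolAt i j)) (value (symbolAt i j)) pt pb
  label (finished pt pb)      = letter true false false pt pb

  leave : Bool → Bool → List (Fin p) → State × List (Fin p)
  leave pt pb []          = finished pt pb , []
  leave pt pb (i′ ∷ rest) = reading i′ 0 pt pb , rest

  advanceIn : ∀ {i j} → Dec (suc j < len i) → Bool → Bool → List (Fin p) → State × List (Fin p)
  advanceIn {i} {j} (yes _) pt pb rest = reading i (suc j) pt pb , rest
  advanceIn         (no _)  pt pb rest = leave pt pb rest

  -- The list holds the tiles still to be started; it is consulted only when the current tile ends.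
  advance : State → List (Fin p) → State × List (Fin p)
  advance (reading i j pt pb) = advanceIn (suc j <? len i) (isTop (symbolAt i j) xor pt) (not (isTop (symbolAt i j)) xor pb)
  advance (finished pt pb) rest = finished pt pb , rest

  Initial : State → Set
  Initial s = ∃ λ i → reading i 0 false false ≡ s

  Step : State → State → Set
  Step s s′ = ∃ λ (c : Maybe (Fin p)) → proj₁ (advance s (fromMaybe c)) ≡ s′

  initial? : Decidable Initial
  initial? s = any? λ i → reading i 0 false false ≟ˢ s

  step? : ∀ s s′ → Dec (Step s s′)
  step? s s′ with proj₁ (advance s []) ≟ˢ s′ | any? (λ i → proj₁ (advance s (i ∷ [])) ≟ˢ s′)
  ... | yes e | _          = yes (nothing , e)
  ... | no _  | yes (i , e) = yes (just i , e)
  ... | no ¬e | no ¬f      = no λ { (nothing , e) → ¬e e ; (just i , e) → ¬f (i , e) }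

  Valid : State → Set
  Valid (reading i j _ _) = j < len i
  Valid (finished _ _)    = ⊤

  withParities : (Bool → Bool → State) → List State
  withParities f = concatMap (λ pt → map (f pt) bools) bools

  ∈-withParities : ∀ f pt pb → f pt pb ∈ withParities f
  ∈-withParities f pt pb = ∈-concatMap⁺′ (λ pt → map (f pt) bools) (∈-bools pt) (∈-map⁺ (f pt) (∈-bools pb))

  states : List State
  states = withParities finished
        ++ concatMap (λ i → concatMap (λ j → withParities (reading i j)) (upTo (len i))) (allFin p)

  valid⇒∈ : ∀ s → Valid s → s ∈ states
  valid⇒∈ (finished pt pb) _ = ∈-++⁺ˡ (∈-withParities finished pt pb)
  valid⇒∈ (reading i j pt pb) j<len = ∈-++⁺ʳ (withParities finished)
    (∈-concatMap⁺′ _ (∈-allFin i) (∈-concatMap⁺′ _ (∈-upTo⁺ j<len) (∈-withParities (reading i j) pt pb)))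

  advance-[]-valid : ∀ s → Valid (proj₁ (advance s []))
  advance-[]-valid (reading i j pt pb) with suc j <? len i
  ... | yes lt = lt
  ... | no _   = tt
  advance-[]-valid (finished pt pb) = tt

  open Enumerated states Initial initial? Step step? label (λ s → proj₁ (advance s []))
                  (λ s → nothing , refl) (λ s → valid⇒∈ _ (advance-[]-valid s)) public

module PCPRuns (P : List Tile) where

  open PCPKripke P

  decode-label : ∀ s → decode (label s) ≡ currentSymbol s
  decode-label (reading i j pt pb) with symbolAt i j
  ... | top b = refl
  ... | bot b = refl
  decode-label (finished pt pb) = refl

  advance-topParity : ∀ s rest → topParity (proj₁ (advance s rest)) ≡ label s topₐ xor topParity s
  advance-topParity (reading i j pt pb) rest with suc j <? len i | rest
  ... | yes _ | _     = refl
  ... | no _  | []    = refl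
  ... | no _  | _ ∷ _ = refl
  advance-topParity (finished pt pb) rest = refl

  advance-botParity : ∀ s rest → botParity (proj₁ (advance s rest)) ≡ isBottom (label s) xor botParity s
  advance-botParity (reading i j pt pb) rest with suc j <? len i | rest
  ... | yes _ | _     = refl
  ... | no _  | []    = refl
  ... | no _  | _ ∷ _ = refl
  advance-botParity (finished pt pb) rest = refl

  remaining : State → List (Fin p) → List Symbol
  remaining (reading i j _ _) rest = drop j (word i) ++ concatMap word rest
  remaining (finished _ _)    _    = []

  remaining-advance : ∀ {i j} pt pb rest → j < len i →
                      remaining (reading i j pt pb) rest ≡ symbolAt i j ∷ uncurry remaining (advance (reading i j pt pb) rest)
  remaining-advance {i} {j} pt pb rest j<len with suc j <? len i | rest
  ... | yes _   | _      rewrite drop-lookupOr (bot false) (word i) j j<len = refl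
  ... | no j+1≮ | []     rewrite drop-lookupOr (bot false) (word i) j j<len | drop-≥length (word i) (suc j) j+1≮ = refl
  ... | no j+1≮ | _ ∷ _  rewrite drop-lookupOr (bot false) (word i) j j<len | drop-≥length (word i) (suc j) j+1≮ = refl

  remaining-step : ∀ {i j} pt pb c rest′ → j < len i →
                   ∃ λ rest → remaining (reading i j pt pb) rest
                              ≡ symbolAt i j ∷ remaining (proj₁ (advance (reading i j pt pb) (fromMaybe c))) rest′
  remaining-step {i} {j} pt pb c rest′ j<len with suc j <? len i | remaining-advance {i} {j} pt pb | c
  ... | yes _ | unfold | _        = rest′ , unfold rest′ j<len
  ... | no _  | unfold | nothing  = [] , unfold [] j<len
  ... | no _  | unfold | just i′  = i′ ∷ rest′ , unfold (i′ ∷ rest′) j<len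

  module Nonempty (nonempty : ∀ i → 0 < len i) where

    advance-valid : ∀ s rest → Valid s → Valid (proj₁ (advance s rest))
    advance-valid (reading i j pt pb) rest _ with suc j <? len i | rest
    ... | yes j+1<len | _      = j+1<len
    ... | no _        | []     = tt
    ... | no _        | i′ ∷ _ = nonempty i′
    advance-valid (finished pt pb) rest _ = tt

  module Facts {σ : Trace 5} (ρ : Run σ) where
    open Run ρ

    decode-σ : ∀ q → decode (σ q) ≡ currentSymbol (at q)
    decode-σ q = trans (decode-cong (labelled q)) (decode-label (at q))

    step-advance : ∀ q → ∃ λ c → at (suc q) ≡ proj₁ (advance (at q) (fromMaybe c))
    step-advance q = let c , e = step q in c , sym e

    parity-σ : ∀ a (f : Letter 5 → Bool) (par : State → Bool) →
               (∀ {ℓ ℓ′} → (∀ b → ℓ b ≡ ℓ′ b) → f ℓ ≡ f ℓ′) →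
               (∀ s → label s a ≡ par s) →
               (∀ s rest → par (proj₁ (advance s rest)) ≡ f (label s) xor par s) →
               (∀ i → par (reading i 0 false false) ≡ false) →
               ∀ q → σ q a ≡ parity (countTrue (λ r → f (σ r)) q)
    parity-σ a f par f-cong label-par advance-par start-par = go
      where
        open ≡-Reasoning
        go : ∀ q → σ q a ≡ parity (countTrue (λ r → f (σ r)) q)
        go zero with initial
        ... | i , at0 = trans (labelled 0 a) (trans (label-par (at 0)) (trans (cong par (sym at0)) (start-par i)))
        go (suc q) with step-advance q
        ... | c , e = begin
          σ (suc q) a                                      ≡⟨ trans (labelled (suc q) a) (label-par (at (suc q))) ⟩
          par (at (suc q))                                 ≡⟨ cong par e ⟩
          par (proj₁ (advance (at q) (fromMaybe c)))       ≡⟨ advance-par (at q) _ ⟩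
          f (label (at q)) xor par (at q)                  ≡⟨ cong₂ _xor_ (f-cong (λ b → sym (labelled q b)))
                                                                          (trans (sym (trans (labelled q a) (label-par (at q)))) (go q)) ⟩
          f (σ q) xor parity (countTrue (λ r → f (σ r)) q) ≡⟨ sym (parity-+bit (countTrue (λ r → f (σ r)) q) (f (σ q))) ⟩
          parity (countTrue (λ r → f (σ r)) (suc q))       ∎

    topParity-σ : ∀ q → σ q ptₐ ≡ parity (countTrue (λ r → σ r topₐ) q)
    topParity-σ = parity-σ ptₐ (λ ℓ → ℓ topₐ) topParity (λ ℓ≗ℓ′ → ℓ≗ℓ′ topₐ)
                    (λ { (reading _ _ _ _) → refl ; (finished _ _) → refl }) advance-topParity (λ _ → refl)

    botParity-σ : ∀ q → σ q pbₐ ≡ parity (countTrue (λ r → isBottom (σ r)) q)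
    botParity-σ = parity-σ pbₐ isBottom botParity (λ ℓ≗ℓ′ → cong₂ (λ e t → not e ∧ not t) (ℓ≗ℓ′ endₐ) (ℓ≗ℓ′ topₐ))
                    (λ { (reading _ _ _ _) → refl ; (finished _ _) → refl }) advance-botParity (λ _ → refl)

    finished-stable : ∀ {pt pb} q → at q ≡ finished pt pb → ∀ d → at (d + q) ≡ finished pt pb
    finished-stable q at-q zero    = at-q
    finished-stable q at-q (suc d) with step-advance (d + q)
    ... | c , e rewrite finished-stable q at-q d = e

    ended : ∀ q → σ q endₐ ≡ true → ∃₂ λ pt pb → at q ≡ finished pt pb
    ended q end with at q in at-q | labelled q endₐ
    ... | finished pt pb  | _       = pt , pb , refl
    ... | reading _ _ _ _ | not-end with () ← trans (sym not-end) end

    decode-end : ∀ q → σ q endₐ ≡ true → decode (σ q) ≡ nothing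
    decode-end q end with ended q end
    ... | _ , _ , at-q = trans (decode-σ q) (cong currentSymbol at-q)

    end-stable : ∀ {q q′} → σ q endₐ ≡ true → q ≤ q′ → ∀ a → σ q′ a ≡ σ q a
    end-stable {q} {q′} end q≤q′ a with ended q end
    ... | pt , pb , at-q = begin
      σ q′ a                    ≡⟨ cong (λ r → σ r a) (sym (m∸n+n≡m q≤q′)) ⟩
      σ (q′ ∸ q + q) a          ≡⟨ labelled _ a ⟩
      label (at (q′ ∸ q + q)) a ≡⟨ cong (λ s → label s a) (trans (finished-stable q at-q (q′ ∸ q)) (sym at-q)) ⟩
      label (at q) a            ≡⟨ sym (labelled q a) ⟩
      σ q a                     ∎
      where open ≡-Reasoning

  module Spelling (nonempty : ∀ i → 0 < len i) {σ : Trace 5} (ρ : Run σ) where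
    open Run ρ
    open Facts ρ
    open Nonempty nonempty

    valid : ∀ q → Valid (at q)
    valid zero with initial
    ... | i , at0 = subst Valid at0 (nonempty i)
    valid (suc q) with step-advance q
    ... | c , e = subst Valid (sym e) (advance-valid (at q) _ (valid q))

    remaining-spells : ∀ d q → σ (d + q) endₐ ≡ true →
                       ∃ λ rest → ∀ n → remaining (at q) rest !? n ≡ decode (σ (n + q))
    remaining-spells d q end with at q in at-q | valid q | step-advance q
    ... | finished pt pb | _ | _ =
      [] , λ n → sym (trans (decode-σ (n + q)) (cong currentSymbol (finished-stable q at-q n)))
    remaining-spells zero q end | reading i j pt pb | _ | _
      with () ← trans (sym end) (trans (labelled q endₐ) (cong (λ s → label s endₐ) at-q))
    remaining-spells (suc d) q end | reading i j pt pb | j<len | c , at-q+1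
      with remaining-spells d (suc q) (subst (λ r → σ r endₐ ≡ true) (sym (+-suc d q)) end)
    ... | rest′ , spells′ with remaining-step pt pb c rest′ j<len
    ...   | rest , unfold = rest , λ
      { zero    → trans (cong (_!? 0) unfold) (sym (trans (decode-σ q) (cong currentSymbol at-q)))
      ; (suc n) → trans (cong (_!? suc n) unfold)
                        (trans (cong (λ s → remaining s rest′ !? n) (sym at-q+1))
                               (trans (spells′ n) (cong (λ r → decode (σ r)) (+-suc n q))))
      }

    spells : ∀ {e} → σ e endₐ ≡ true → ∃ λ I → I ≢ [] × Spells (concatMap word I) σ
    spells {e} end with initial | remaining-spells e 0 (subst (λ r → σ r endₐ ≡ true) (sym (+-identityʳ e)) end)
    ... | i , at0 | rest , spells-rest =
      i ∷ rest , (λ ()) , λ n → trans (cong (λ s → remaining s rest !? n) at0)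
                                     (trans (spells-rest n) (cong (λ r → decode (σ r)) (+-identityʳ n)))

+bit-grows : ∀ {j} a c b d → j ≤ a + c → b ≡ true ⊎ d ≡ true → suc j ≤ (a + bit b) + (c + bit d)
+bit-grows {j} a c b d j≤a+c b∨d = ≤-trans (s≤s j≤a+c) (growth b d b∨d)
  where
    growth : ∀ b d → b ≡ true ⊎ d ≡ true → suc (a + c) ≤ (a + bit b) + (c + bit d)
    growth true  d _ = ≤-trans (≤-reflexive (cong (_+ c) (+-comm 1 a))) (+-monoʳ-≤ (a + 1) (m≤m+n c (bit d)))
    growth false true  _ = ≤-reflexive (trans (sym (+-suc a c)) (cong₂ _+_ (sym (+-identityʳ a)) (+-comm 1 c)))
    growth false false (inj₁ ())
    growth false false (inj₂ ())

-- Two pointers run over a word whose top bits equal its bottom bits: x skips bottom symbols,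
-- y skips top symbols, and otherwise both advance, so x and y sit on corresponding symbols.
module Alignment (W : List Symbol) (balanced : tops W ≡ bots W) where

  L : ℕ
  L = length W

  topsBefore botsBefore : ℕ → ℕ
  topsBefore = selectedBefore topBit W
  botsBefore = selectedBefore botBit W

  data Move : Set where
    moveX moveY moveBoth : Move

  movesX movesY : Move → Bool
  movesX moveX    = true
  movesX moveY    = false
  movesX moveBoth = true
  movesY moveX    = false
  movesY moveY    = true
  movesY moveBoth = true

  move : Maybe Symbol → Maybe Symbol → Move
  move (just (bot _)) _              = moveX
  move (just (top _)) (just (top _)) = moveY
  move nothing        (just (top _)) = moveY
  move _              _              = moveBoth

  positions : ℕ → ℕ × ℕ
  positions zero    = 0 , 0
  positions (suc j) = let (px , py) = positions j ; m = move (W !? px) (W !? py) in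
                      px + bit (movesX m) , py + bit (movesY m)

  px py : ℕ → ℕ
  px j = proj₁ (positions j)
  py j = proj₂ (positions j)

  moveAt : ℕ → Move
  moveAt j = move (W !? px j) (W !? py j)

  px≡countTrue : ∀ j → px j ≡ countTrue (λ i → movesX (moveAt i)) j
  px≡countTrue zero    = refl
  px≡countTrue (suc j) = cong (_+ bit (movesX (moveAt j))) (px≡countTrue j)

  py≡countTrue : ∀ j → py j ≡ countTrue (λ i → movesY (moveAt i)) j
  py≡countTrue zero    = refl
  py≡countTrue (suc j) = cong (_+ bit (movesY (moveAt j))) (py≡countTrue j)

  moves-someone : ∀ m → movesX m ≡ true ⊎ movesY m ≡ true
  moves-someone moveX    = inj₁ refl
  moves-someone moveY    = inj₂ refl
  moves-someone moveBoth = inj₁ refl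

  unbalanced-top : ∀ {p q a} → topsBefore p ≡ botsBefore q → W !? p ≡ just (top a) → W !? q ≡ nothing → ⊥
  unbalanced-top {p} {q} same Wp Wq = <⇒≢ (selectedBefore-< topBit W p Wp refl)
    (trans same (trans (selectedBefore-all botBit W q (!?-nothing⇒≥ W q Wq)) (cong length (sym balanced))))

  unbalanced-bot : ∀ {p q a} → topsBefore p ≡ botsBefore q → W !? p ≡ nothing → W !? q ≡ just (bot a) → ⊥
  unbalanced-bot {p} {q} same Wp Wq = <⇒≢ (selectedBefore-< botBit W q Wq refl)
    (trans (sym same) (trans (selectedBefore-all topBit W p (!?-nothing⇒≥ W p Wp)) (cong length balanced)))

  balanced-positions : ∀ j → topsBefore (px j) ≡ botsBefore (py j)
  balanced-positions zero    = refl
  balanced-positions (suc j) with W !? px j in Wp | W !? py j in Wq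
  ... | just (bot _) | _ rewrite selectedBefore-+bit topBit W (px j) true | selectedBefore-+bit botBit W (py j) false | Wp
    = cong (_+ 0) (balanced-positions j)
  ... | just (top _) | just (top _) rewrite selectedBefore-+bit topBit W (px j) false | selectedBefore-+bit botBit W (py j) true | Wq
    = cong (_+ 0) (balanced-positions j)
  ... | nothing | just (top _) rewrite selectedBefore-+bit topBit W (px j) false | selectedBefore-+bit botBit W (py j) true | Wq
    = cong (_+ 0) (balanced-positions j)
  ... | just (top _) | just (bot _) rewrite selectedBefore-+bit topBit W (px j) true | selectedBefore-+bit botBit W (py j) true | Wp | Wq
    = cong (_+ 1) (balanced-positions j)
  ... | nothing | nothing rewrite selectedBefore-+bit topBit W (px j) true | selectedBefore-+bit botBit W (py j) true | Wp | Wq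
    = cong (_+ 0) (balanced-positions j)
  ... | just (top _) | nothing      = ⊥-elim (unbalanced-top (balanced-positions j) Wp Wq)
  ... | nothing      | just (bot _) = ⊥-elim (unbalanced-bot (balanced-positions j) Wp Wq)

  BothPast : ℕ → Set
  BothPast j = L ≤ px j × L ≤ py j

  +bit-within : ∀ {p} b → p ≤ L → (b ≡ true → p < L) → p + bit b ≤ L
  +bit-within true  _   p<L = subst (_≤ L) (+-comm 1 _) (p<L refl)
  +bit-within false p≤L _   = subst (_≤ L) (sym (+-identityʳ _)) p≤L

  -- Until both pointers have run off the word, every step advances one of them inside it.
  progress : ∀ j → BothPast j ⊎ (j ≤ px j + py j × px j ≤ L × py j ≤ L)
  progress zero = inj₂ (z≤n , z≤n , z≤n)
  progress (suc j) with progress j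
  ... | inj₁ (L≤x , L≤y) = inj₁ (≤-trans L≤x (m≤m+n _ _) , ≤-trans L≤y (m≤m+n _ _))
  ... | inj₂ (j≤x+y , x≤L , y≤L) with W !? px j in Wp | W !? py j in Wq
  ...   | just (bot _) | _ = inj₂ (+bit-grows (px j) (py j) true false j≤x+y (inj₁ refl)
                                  , +bit-within true x≤L (λ _ → !?-just⇒< W _ Wp) , +bit-within false y≤L λ ())
  ...   | just (top _) | just (top _) = inj₂ (+bit-grows (px j) (py j) false true j≤x+y (inj₂ refl)
                                  , +bit-within false x≤L (λ ()) , +bit-within true y≤L (λ _ → !?-just⇒< W _ Wq))
  ...   | nothing      | just (top _) = inj₂ (+bit-grows (px j) (py j) false true j≤x+y (inj₂ refl)
                                  , +bit-within false x≤L (λ ()) , +bit-within true y≤L (λ _ → !?-just⇒< W _ Wq))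
  ...   | just (top _) | just (bot _) = inj₂ (+bit-grows (px j) (py j) true true j≤x+y (inj₁ refl)
                                  , +bit-within true x≤L (λ _ → !?-just⇒< W _ Wp) , +bit-within true y≤L (λ _ → !?-just⇒< W _ Wq))
  ...   | nothing      | nothing      = inj₁ (≤-trans (!?-nothing⇒≥ W _ Wp) (m≤m+n _ _) , ≤-trans (!?-nothing⇒≥ W _ Wq) (m≤m+n _ _))
  ...   | just (top _) | nothing      = ⊥-elim (unbalanced-top (balanced-positions j) Wp Wq)
  ...   | nothing      | just (bot _) = ⊥-elim (unbalanced-bot (balanced-positions j) Wp Wq)

  finishTime : ℕ
  finishTime = suc (L + L)

  bothPast : ∀ d → BothPast (d + finishTime)
  bothPast zero with progress finishTime
  ... | inj₁ done = done
  ... | inj₂ (t≤x+y , x≤L , y≤L) = ⊥-elim (<⇒≱ (s≤s ≤-refl) (≤-trans t≤x+y (+-mono-≤ x≤L y≤L)))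
  bothPast (suc d) = let (L≤x , L≤y) = bothPast d in ≤-trans L≤x (m≤m+n _ _) , ≤-trans L≤y (m≤m+n _ _)

  moveAt-bothPast : ∀ d → moveAt (d + finishTime) ≡ moveBoth
  moveAt-bothPast d rewrite !?-≥length W _ (proj₁ (bothPast d)) | !?-≥length W _ (proj₂ (bothPast d)) = refl

  x-moves-often : ∀ i → ∃ λ j → i ≤ j × movesX (moveAt j) ≡ true
  x-moves-often i = i + finishTime , m≤m+n i _ , cong movesX (moveAt-bothPast i)

  y-moves-often : ∀ i → ∃ λ j → i ≤ j × movesY (moveAt j) ≡ true
  y-moves-often i = i + finishTime , m≤m+n i _ , cong movesY (moveAt-bothPast i)

-- The formula, and solutions from its models

sameParities sameLetter aligned matching bothEnded : StateFormula
sameParities = (atᶠ ptₐ x ⇔ᶠ atᶠ ptₐ y) ∧ᶠ (atᶠ pbₐ x ⇔ᶠ atᶠ pbₐ y)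
sameLetter   = (atᶠ endₐ x ⇔ᶠ atᶠ endₐ y) ∧ᶠ (atᶠ topₐ x ⇔ᶠ atᶠ topₐ y) ∧ᶠ (atᶠ bitₐ x ⇔ᶠ atᶠ bitₐ y)
aligned      = atᶠ ptₐ x ⇔ᶠ atᶠ pbₐ y
matching     = (atᶠ topₐ x ∧ᶠ ¬ᶠ atᶠ endₐ y ∧ᶠ ¬ᶠ atᶠ topₐ y) ⇒ᶠ (atᶠ bitₐ x ⇔ᶠ atᶠ bitₐ y)
bothEnded    = atᶠ endₐ x ∧ᶠ atᶠ endₐ y

sameLetterᵇ : Letter 5 → Letter 5 → Bool
sameLetterᵇ ℓ ℓ′ = (ℓ endₐ ⇔ᵇ ℓ′ endₐ) ∧ (ℓ topₐ ⇔ᵇ ℓ′ topₐ) ∧ (ℓ bitₐ ⇔ᵇ ℓ′ bitₐ)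

sameLetterᵇ-≗ : ∀ {ℓ ℓ′} → (∀ a → ℓ a ≡ ℓ′ a) → sameLetterᵇ ℓ ℓ′ ≡ true
sameLetterᵇ-≗ {ℓ} ℓ≗ℓ′ rewrite sym (ℓ≗ℓ′ endₐ) | sym (ℓ≗ℓ′ topₐ) | sym (ℓ≗ℓ′ bitₐ)
  | ⇔ᵇ-refl (ℓ endₐ) | ⇔ᵇ-refl (ℓ topₐ) | ⇔ᵇ-refl (ℓ bitₐ) = refl

sameLetterᵇ≡true⁻ : ∀ ℓ ℓ′ → sameLetterᵇ ℓ ℓ′ ≡ true →
                    ℓ endₐ ≡ ℓ′ endₐ × ℓ topₐ ≡ ℓ′ topₐ × ℓ bitₐ ≡ ℓ′ bitₐ
sameLetterᵇ≡true⁻ ℓ ℓ′ same =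
  let e , tb = ∧≡true⁻ {ℓ endₐ ⇔ᵇ ℓ′ endₐ} same ; t , b = ∧≡true⁻ {ℓ topₐ ⇔ᵇ ℓ′ topₐ} tb
  in ⇔ᵇ≡true⁻ e , ⇔ᵇ≡true⁻ t , ⇔ᵇ≡true⁻ b

differs alignsTopsWithBottoms : PathF 5
differs               = toPath sameParities U toPath (sameParities ∧ᶠ ¬ᶠ sameLetter)
alignsTopsWithBottoms = toPath (aligned ∧ᶠ matching) U toPath (aligned ∧ᶠ bothEnded)

pcpFormula : Formula 5
pcpFormula = ∃' (var x) (∀' (var y) (E (differs ∨' alignsTopsWithBottoms)))

pcpFormula-closed : Closed pcpFormula
pcpFormula-closed = (λ ()) , (λ { (here ()) ; (there ()) })
                  , ( (toPath-closed sameParities , toPath-closed (sameParities ∧ᶠ ¬ᶠ sameLetter))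
                    , (toPath-closed (aligned ∧ᶠ matching) , toPath-closed (aligned ∧ᶠ bothEnded)))

module Extraction (P : List Tile) (nonempty : ∀ i → 0 < PCPKripke.len P i) where
  open PCPKripke P
  open PCPRuns P

  module SelfComparison {σ : Trace 5} (ρ : Run σ) where
    open Run ρ
    open Facts ρ
    open Evaluation σ σ

    topCount botCount : ℕ → ℕ
    topCount = countTrue (λ q → σ q topₐ)
    botCount = countTrue (λ q → isBottom (σ q))

    counts-determine-letter≤ : ∀ {p p′} → p ≤ p′ → topCount p ≡ topCount p′ → botCount p ≡ botCount p′ →
                               ∀ a → σ p′ a ≡ σ p a
    counts-determine-letter≤ {p} {p′} p≤p′ same-tops same-bots a with m≤n⇒m<n∨m≡n p≤p′
    ... | inj₂ refl = refl
    ... | inj₁ p<p′ with σ p endₐ in end | σ p topₐ in top?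
    ...   | true  | _     = end-stable end p≤p′ a
    ...   | false | true  = ⊥-elim (<⇒≢ (countTrue-strict (λ q → σ q topₐ) top? p<p′) same-tops)
    ...   | false | false = ⊥-elim (<⇒≢ (countTrue-strict (λ q → isBottom (σ q)) bottom p<p′) same-bots)
      where bottom : isBottom (σ p) ≡ true
            bottom rewrite end | top? = refl

    counts-determine-letter : ∀ p p′ → topCount p ≡ topCount p′ → botCount p ≡ botCount p′ → ∀ a → σ p a ≡ σ p′ a
    counts-determine-letter p p′ same-tops same-bots a with ≤-total p p′
    ... | inj₁ p≤p′ = sym (counts-determine-letter≤ p≤p′ same-tops same-bots a)
    ... | inj₂ p′≤p = counts-determine-letter≤ p′≤p (sym same-tops) (sym same-bots) a

    -- Equal parities keep the two copies of σ at positions with equal letter counts, hence equal letters.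
    no-self-difference : ∀ {t} → ¬ sat Πxy t 0 differs
    no-self-difference {t} (m , last , before) = contradiction
      where
        parities : ∀ j → j ≤ m → holds t j sameParities ≡ true
        parities j j≤m with m≤n⇒m<n∨m≡n j≤m
        ... | inj₁ j<m  = sat⇒holds t j sameParities (before j j<m)
        ... | inj₂ refl = proj₁ (∧≡true⁻ (sat⇒holds t m (sameParities ∧ᶠ ¬ᶠ sameLetter) last))
        same-counts : ∀ (a : _) (h : ℕ → Bool) → (∀ q → σ q a ≡ parity (countTrue h q)) →
                      (∀ j → j ≤ m → holds t j (atᶠ a x ⇔ᶠ atᶠ a y) ≡ true) →
                      countTrue h (count t 0 m) ≡ countTrue h (count t 1 m)
        same-counts a h parity-a agree = countTrue-along-parity⇒≡ t 0 1 h h m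
          (λ j j≤m → trans (sym (parity-a _)) (trans (⇔ᵇ≡true⁻ (agree j j≤m)) (parity-a _))) m ≤-refl
        same-letter : holds t m sameLetter ≡ true
        same-letter = sameLetterᵇ-≗ (counts-determine-letter (count t 0 m) (count t 1 m)
                        (same-counts ptₐ _ topParity-σ (λ j j≤m → proj₁ (∧≡true⁻ (parities j j≤m))))
                        (same-counts pbₐ _ botParity-σ (λ j j≤m → proj₂ (∧≡true⁻ (parities j j≤m)))))
        contradiction : ⊥
        contradiction with () ← trans (sym (proj₂ (∧≡true⁻ (sat⇒holds t m (sameParities ∧ᶠ ¬ᶠ sameLetter) last))))
                                      (cong not same-letter)

    -- The x-copy walks through the top symbols and the y-copy through the bottom symbols in
    -- lockstep: where the top count reaches k + 1, the y-copy reads bottom symbol k, and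
    -- matching forces both bits to agree.
    module Lockstep {t} (alignment : sat Πxy t 0 alignsTopsWithBottoms) where
      m : ℕ
      m = proj₁ alignment

      cx cy : ℕ → ℕ
      cx = count t 0
      cy = count t 1

      final : holds t m aligned ≡ true × holds t m bothEnded ≡ true
      final = ∧≡true⁻ (sat⇒holds t m (aligned ∧ᶠ bothEnded) (proj₁ (proj₂ alignment)))

      aligned-matching : ∀ j → j < m → holds t j aligned ≡ true × holds t j matching ≡ true
      aligned-matching j j<m = ∧≡true⁻ (sat⇒holds t j (aligned ∧ᶠ matching) (proj₂ (proj₂ alignment) j j<m))

      aligned≤m : ∀ j → j ≤ m → holds t j aligned ≡ true
      aligned≤m j j≤m with m≤n⇒m<n∨m≡n j≤m
      ... | inj₁ j<m  = proj₁ (aligned-matching j j<m)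
      ... | inj₂ refl = proj₁ final

      tops≡bots-count : ∀ j → j ≤ m → topCount (cx j) ≡ botCount (cy j)
      tops≡bots-count = countTrue-along-parity⇒≡ t 0 1 _ _ m λ j j≤m →
        trans (sym (topParity-σ (cx j))) (trans (⇔ᵇ≡true⁻ (aligned≤m j j≤m)) (botParity-σ (cy j)))

      x-ended : σ (cx m) endₐ ≡ true
      x-ended = proj₁ (∧≡true⁻ (proj₂ final))

      y-ended : σ (cy m) endₐ ≡ true
      y-ended = proj₂ (∧≡true⁻ (proj₂ final))

      open Spelling nonempty ρ using (spells)

      I : List (Fin p)
      I = proj₁ (spells x-ended)

      I≢[] : I ≢ []
      I≢[] = proj₁ (proj₂ (spells x-ended))

      W : List Symbol
      W = concatMap word I

      W-spells : Spells W σ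
      W-spells = proj₂ (proj₂ (spells x-ended))

      topCount≡ : ∀ p → topCount p ≡ selectedBefore topBit W p
      topCount≡ = countTrue-spells topBit {W} {σ} (λ ℓ → ℓ topₐ) W-spells topₐ-selects

      botCount≡ : ∀ p → botCount p ≡ selectedBefore botBit W p
      botCount≡ = countTrue-spells botBit {W} {σ} isBottom W-spells isBottom-selects

      past-W : ∀ p → σ p endₐ ≡ true → length W ≤ p
      past-W p end = !?-nothing⇒≥ W p (trans (W-spells p) (decode-end p end))

      length-tops : length (tops W) ≡ topCount (cx m)
      length-tops = sym (trans (topCount≡ (cx m)) (selectedBefore-all topBit W (cx m) (past-W _ x-ended)))

      length-bots : length (bots W) ≡ botCount (cy m)
      length-bots = sym (trans (botCount≡ (cy m)) (selectedBefore-all botBit W (cy m) (past-W _ y-ended)))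

      lengths : length (tops W) ≡ length (bots W)
      lengths = trans length-tops (trans (tops≡bots-count m ≤-refl) (sym length-bots))

      top-at : ∀ p → σ p topₐ ≡ true → tops W !? topCount p ≡ just (σ p bitₐ)
      top-at p reads-top = subst (λ k → tops W !? k ≡ just (σ p bitₐ)) (sym (topCount≡ p))
                                 (spells-top {W} {σ} W-spells p reads-top)

      bot-at : ∀ p → isBottom (σ p) ≡ true → bots W !? botCount p ≡ just (σ p bitₐ)
      bot-at p reads-bottom = subst (λ k → bots W !? k ≡ just (σ p bitₐ)) (sym (botCount≡ p))
                                    (spells-bottom {W} {σ} W-spells p reads-bottom)

      same-!? : ∀ k → tops W !? k ≡ bots W !? k
      same-!? k with k <? length (tops W)
      ... | no k≮ = trans (!?-≥length (tops W) k (≮⇒≥ k≮)) (sym (!?-≥length (bots W) k (subst (_≤ k) lengths (≮⇒≥ k≮))))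
      ... | yes k< with unitSteps-crossing (unitSteps-∘ (count-unitSteps t 0) (countTrue-unitSteps _)) refl m k
                                            (subst (k <_) length-tops k<)
      ...   | e , e<m , up-e , up-e+1 = begin
        tops W !? k                  ≡⟨ cong (tops W !?_) (sym up-e) ⟩
        tops W !? topCount (cx e)    ≡⟨ top-at (cx e) reads-top ⟩
        just (σ (cx e) bitₐ)         ≡⟨ cong just (⇔ᵇ≡true⁻ (⇒ᵇ-mp (proj₂ (aligned-matching e e<m)) reads-top reads-bottom)) ⟩
        just (σ (cy e) bitₐ)         ≡⟨ sym (bot-at (cy e) reads-bottom) ⟩
        bots W !? botCount (cy e)    ≡⟨ cong (bots W !?_) (trans (sym (tops≡bots-count e (<⇒≤ e<m))) up-e) ⟩
        bots W !? k                  ∎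
        where
          open ≡-Reasoning
          reads-top : σ (cx e) topₐ ≡ true
          reads-top = countTrue-crossing _ (count-unitSteps t 0) e (trans up-e+1 (cong suc (sym up-e)))
          reads-bottom : isBottom (σ (cy e)) ≡ true
          reads-bottom = countTrue-crossing _ (count-unitSteps t 1) e
            (trans (sym (tops≡bots-count (suc e) e<m)) (trans up-e+1 (cong suc (trans (sym up-e) (tops≡bots-count e (<⇒≤ e<m))))))

      solution : concatMap (proj₁ ∘ lookup P) I ≡ concatMap (proj₂ ∘ lookup P) I
      solution = begin
        concatMap (proj₁ ∘ lookup P) I ≡⟨ sym (mapMaybe-concatMap-tileWord topBit proj₁ tops-tileWord (lookup P) I) ⟩
        tops W                         ≡⟨ !?-ext (tops W) (bots W) same-!? ⟩
        bots W                         ≡⟨ mapMaybe-concatMap-tileWord botBit proj₂ bots-tileWord (lookup P) I ⟩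
        concatMap (proj₂ ∘ lookup P) I ∎
        where open ≡-Reasoning

  extract : kripke ⊨ pcpFormula → PCPSolvable P
  extract (σ , σ∈K , every-y) with every-y σ σ∈K
  ... | _ , _ , _ , inj₁ difference = ⊥-elim (SelfComparison.no-self-difference (trace⇒run σ∈K) difference)
  ... | _ , _ , _ , inj₂ alignment  = I , I≢[] , solution
    where open SelfComparison.Lockstep (trace⇒run σ∈K) alignment

-- Models from solutions

pairTrajectory : (ℕ → Bool) → (ℕ → Bool) → Trajectory
pairTrajectory a b j 0             = a j
pairTrajectory a b j 1             = b j
pairTrajectory a b j (suc (suc _)) = false

module _ (σx σy : Trace 5) (a b : ℕ → Bool) where
  open Evaluation σx σy using (Πxy)

  pairTrajectory-isTrajectory : (∀ j → a j ≡ true ⊎ b j ≡ true) → IsTrajectory Πxy (pairTrajectory a b)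
  pairTrajectory-isTrajectory a∨b = over , nonempty
    where
      over : ∀ j π → pairTrajectory a b j π ≡ true → InDom Πxy π
      over j 0 _ = there (here refl)
      over j 1 _ = here refl
      nonempty : ∀ j → ∃ λ π → pairTrajectory a b j π ≡ true
      nonempty j with a∨b j
      ... | inj₁ a-j = 0 , a-j
      ... | inj₂ b-j = 1 , b-j

  pairTrajectory-fair : (∀ i → ∃ λ j → i ≤ j × a j ≡ true) → (∀ i → ∃ λ j → i ≤ j × b j ≡ true) →
                        Fair Πxy (pairTrajectory a b)
  pairTrajectory-fair a-often b-often .1 (here refl)         = b-often
  pairTrajectory-fair a-often b-often .0 (there (here refl)) = a-often

count-pairTrajectory-x : ∀ a b i → count (pairTrajectory a b) 0 i ≡ countTrue a i
count-pairTrajectory-x a b zero    = refl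
count-pairTrajectory-x a b (suc i) = cong (_+ bit (a i)) (count-pairTrajectory-x a b i)

count-pairTrajectory-y : ∀ a b i → count (pairTrajectory a b) 1 i ≡ countTrue b i
count-pairTrajectory-y a b zero    = refl
count-pairTrajectory-y a b (suc i) = cong (_+ bit (b i)) (count-pairTrajectory-y a b i)

module Walks (P : List Tile) (nonempty : ∀ i → 0 < PCPKripke.len P i) where
  open PCPKripke P
  open PCPRuns P
  open Nonempty nonempty

  walk : State → List (Fin p) → ℕ → State
  walk s rest zero    = s
  walk s rest (suc n) = walk (proj₁ (advance s rest)) (proj₂ (advance s rest)) n

  walk-valid : ∀ n s rest → Valid s → Valid (walk s rest n)
  walk-valid zero    s rest v = v
  walk-valid (suc n) s rest v = walk-valid n _ _ (advance-valid s rest v)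

  advance-head : ∀ s rest → proj₁ (advance s (fromMaybe (head rest))) ≡ proj₁ (advance s rest)
  advance-head (reading i j pt pb) rest with suc j <? len i | rest
  ... | yes _ | _     = refl
  ... | no _  | []    = refl
  ... | no _  | _ ∷ _ = refl
  advance-head (finished pt pb) rest = refl

  walk-step : ∀ n s rest → Step (walk s rest n) (walk s rest (suc n))
  walk-step zero    s rest = head rest , advance-head s rest
  walk-step (suc n) s rest = walk-step n _ _

  walk-finished : ∀ n pt pb rest → walk (finished pt pb) rest n ≡ finished pt pb
  walk-finished zero    pt pb rest = refl
  walk-finished (suc n) pt pb rest = walk-finished n pt pb rest

  remaining-walk : ∀ n s rest → Valid s → remaining s rest !? n ≡ currentSymbol (walk s rest n)
  remaining-walk n       (finished pt pb)    rest _     rewrite walk-finished n pt pb rest = refl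
  remaining-walk zero    (reading i j pt pb) rest j<len rewrite remaining-advance pt pb rest j<len = refl
  remaining-walk (suc n) (reading i j pt pb) rest j<len rewrite remaining-advance pt pb rest j<len =
    remaining-walk n _ _ (advance-valid (reading i j pt pb) rest j<len)

  reads : Fin p → List (Fin p) → Trace 5
  reads i rest n = label (walk (reading i 0 false false) rest n)

  readsRun : ∀ i rest → Run (reads i rest)
  readsRun i rest = record
    { at       = walk (reading i 0 false false) rest
    ; initial  = i , refl
    ; step     = λ n → walk-step n _ rest
    ; labelled = λ _ _ → refl
    }

  reads-trace : ∀ i rest → IsTrace kripke (reads i rest)
  reads-trace i rest = run⇒trace (readsRun i rest) λ n → valid⇒∈ _ (walk-valid n _ rest (nonempty i))

  reads-spells : ∀ i rest → Spells (concatMap word (i ∷ rest)) (reads i rest)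
  reads-spells i rest n = trans (remaining-walk n _ rest (nonempty i)) (sym (decode-label _))

module Construction (P : List Tile) (nonempty : ∀ i → 0 < PCPKripke.len P i) where
  open PCPKripke P
  open PCPRuns P
  open Walks P nonempty

  module Witness (i₀ : Fin p) (rest : List (Fin p))
                 (solves : concatMap (proj₁ ∘ lookup P) (i₀ ∷ rest) ≡ concatMap (proj₂ ∘ lookup P) (i₀ ∷ rest)) where

    σx : Trace 5
    σx = reads i₀ rest

    module X = Facts (readsRun i₀ rest)

    W : List Symbol
    W = concatMap word (i₀ ∷ rest)

    W-spells : Spells W σx
    W-spells = reads-spells i₀ rest

    balanced : tops W ≡ bots W
    balanced = begin
      tops W                                ≡⟨ mapMaybe-concatMap-tileWord topBit proj₁ tops-tileWord (lookup P) (i₀ ∷ rest) ⟩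
      concatMap (proj₁ ∘ lookup P) (i₀ ∷ rest) ≡⟨ solves ⟩
      concatMap (proj₂ ∘ lookup P) (i₀ ∷ rest) ≡⟨ sym (mapMaybe-concatMap-tileWord botBit proj₂ bots-tileWord (lookup P) (i₀ ∷ rest)) ⟩
      bots W                                ∎
      where open ≡-Reasoning

    module Against {σy : Trace 5} (ρy : Run σy) where
      module Y = Facts ρy
      open Evaluation σx σy

      Witnessed : Set
      Witnessed = Σ Trajectory λ t → IsTrajectory Πxy t × Fair Πxy t × sat Πxy t 0 (differs ∨' alignsTopsWithBottoms)

      -- The synchronous trajectory exhibits the first letter where y leaves x.
      differing : ∀ q → sameLetterᵇ (σx q) (σy q) ≡ false → (∀ j → j < q → sameLetterᵇ (σx j) (σy j) ≡ true) → Witnessed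
      differing q differ agree-before =
          t , pairTrajectory-isTrajectory σx σy _ _ (λ _ → inj₁ refl)
            , pairTrajectory-fair σx σy _ _ (λ i → i , ≤-refl , refl) (λ i → i , ≤-refl , refl)
            , inj₁ (q , holds⇒sat t q (sameParities ∧ᶠ ¬ᶠ sameLetter) (trans (synchronous q (sameParities ∧ᶠ ¬ᶠ sameLetter)) last)
                   , λ j j<q → holds⇒sat t j sameParities (trans (synchronous j sameParities) (parities j (<⇒≤ j<q))))
        where
          t : Trajectory
          t = pairTrajectory (λ _ → true) (λ _ → true)
          synchronous : ∀ j φ → holds t j φ ≡ holdsAt j j φ
          synchronous j φ = cong₂ (λ px py → holdsAt px py φ) (trans (count-pairTrajectory-x _ _ j) (countTrue-true j))
                                                             (trans (count-pairTrajectory-y _ _ j) (countTrue-true j))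
          agree : ∀ {j} r → r < j → j ≤ q → σx r endₐ ≡ σy r endₐ × σx r topₐ ≡ σy r topₐ × σx r bitₐ ≡ σy r bitₐ
          agree r r<j j≤q = sameLetterᵇ≡true⁻ (σx r) (σy r) (agree-before r (<-≤-trans r<j j≤q))
          parities : ∀ j → j ≤ q → holdsAt j j sameParities ≡ true
          parities j j≤q rewrite
              ⇔ᵇ-≡ (trans (X.topParity-σ j) (trans (cong parity (countTrue-cong j λ r r<j → proj₁ (proj₂ (agree r r<j j≤q)))) (sym (Y.topParity-σ j))))
            | ⇔ᵇ-≡ (trans (X.botParity-σ j) (trans (cong parity (countTrue-cong j λ r r<j →
                      let e , t , _ = agree r r<j j≤q in cong₂ (λ e t → not e ∧ not t) e t)) (sym (Y.botParity-σ j))))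
            = refl
          last : holdsAt q q (sameParities ∧ᶠ ¬ᶠ sameLetter) ≡ true
          last rewrite parities q ≤-refl | differ = refl

      -- If y agrees with x up to the end of W, it agrees with x everywhere, and the alignment
      -- of the tops of W with its bottoms is a trajectory satisfying the second disjunct.
      module Agreeing (agree-to-L : ∀ j → j ≤ Alignment.L W balanced → sameLetterᵇ (σx j) (σy j) ≡ true) where
        open Alignment W balanced

        t : Trajectory
        t = pairTrajectory (movesX ∘ moveAt) (movesY ∘ moveAt)

        at-positions : ∀ j φ → holds t j φ ≡ holdsAt (px j) (py j) φ
        at-positions j φ = cong₂ (λ px py → holdsAt px py φ) (trans (count-pairTrajectory-x _ _ j) (sym (px≡countTrue j)))
                                                             (trans (count-pairTrajectory-y _ _ j) (sym (py≡countTrue j)))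

        x-ended : ∀ q → L ≤ q → σx q endₐ ≡ true
        x-ended q L≤q = decode-nothing (σx q) (trans (sym (W-spells q)) (!?-≥length W q L≤q))

        y-ended-L : σy L endₐ ≡ true
        y-ended-L = trans (sym (proj₁ (sameLetterᵇ≡true⁻ (σx L) (σy L) (agree-to-L L ≤-refl)))) (x-ended L ≤-refl)

        agree-at : ∀ q a → σx L a ≡ σy L a → L ≤ q → σx q a ≡ σy q a
        agree-at q a same-at-L L≤q = trans (X.end-stable (x-ended L ≤-refl) L≤q a) (trans same-at-L (sym (Y.end-stable y-ended-L L≤q a)))

        agree : ∀ q → σx q endₐ ≡ σy q endₐ × σx q topₐ ≡ σy q topₐ × σx q bitₐ ≡ σy q bitₐ
        agree q with q ≤? L
        ... | yes q≤L = sameLetterᵇ≡true⁻ (σx q) (σy q) (agree-to-L q q≤L)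
        ... | no q≰L  = let e , t , b = sameLetterᵇ≡true⁻ (σx L) (σy L) (agree-to-L L ≤-refl) ; L≤q = <⇒≤ (≰⇒> q≰L) in
                        agree-at q endₐ e L≤q , agree-at q topₐ t L≤q , agree-at q bitₐ b L≤q

        same-bottom : ∀ q → isBottom (σx q) ≡ isBottom (σy q)
        same-bottom q = let e , t , _ = agree q in cong₂ (λ e t → not e ∧ not t) e t

        same-botParity : ∀ q → σx q pbₐ ≡ σy q pbₐ
        same-botParity q = trans (X.botParity-σ q) (trans (cong parity (countTrue-cong q λ r _ → same-bottom r)) (sym (Y.botParity-σ q)))

        topsBefore≡ : ∀ p → countTrue (λ q → σx q topₐ) p ≡ topsBefore p
        topsBefore≡ = countTrue-spells topBit {W} {σx} (λ ℓ → ℓ topₐ) W-spells topₐ-selects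

        botsBefore≡ : ∀ p → countTrue (λ q → isBottom (σx q)) p ≡ botsBefore p
        botsBefore≡ = countTrue-spells botBit {W} {σx} isBottom W-spells isBottom-selects

        aligned-at : ∀ j → holdsAt (px j) (py j) aligned ≡ true
        aligned-at j = ⇔ᵇ-≡ (begin
          σx (px j) ptₐ                 ≡⟨ X.topParity-σ (px j) ⟩
          parity (countTrue _ (px j))   ≡⟨ cong parity (trans (topsBefore≡ (px j)) (trans (balanced-positions j) (sym (botsBefore≡ (py j))))) ⟩
          parity (countTrue _ (py j))   ≡⟨ sym (X.botParity-σ (py j)) ⟩
          σx (py j) pbₐ                 ≡⟨ same-botParity (py j) ⟩
          σy (py j) pbₐ                 ∎)
          where open ≡-Reasoning

        matching-at : ∀ j → holdsAt (px j) (py j) matching ≡ true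
        matching-at j = ⇒ᵇ-intro λ x-top y-bottom → ⇔ᵇ-≡ (just-injective (begin
          just (σx (px j) bitₐ)         ≡⟨ sym (spells-top {W} {σx} W-spells (px j) x-top) ⟩
          tops W !? topsBefore (px j)   ≡⟨ cong₂ _!?_ balanced (balanced-positions j) ⟩
          bots W !? botsBefore (py j)   ≡⟨ spells-bottom {W} {σx} W-spells (py j) (trans (same-bottom (py j)) y-bottom) ⟩
          just (σx (py j) bitₐ)         ≡⟨ cong just (proj₂ (proj₂ (agree (py j)))) ⟩
          just (σy (py j) bitₐ)         ∎))
          where open ≡-Reasoning

        aligned-matching : ∀ j → holdsAt (px j) (py j) (aligned ∧ᶠ matching) ≡ true
        aligned-matching j rewrite aligned-at j | matching-at j = refl

        ends : holdsAt (px finishTime) (py finishTime) (aligned ∧ᶠ bothEnded) ≡ true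
        ends rewrite aligned-at finishTime | x-ended _ (proj₁ (bothPast 0))
                   | sym (proj₁ (agree (py finishTime))) | x-ended _ (proj₂ (bothPast 0)) = refl

        witnessed : Witnessed
        witnessed =
            t , pairTrajectory-isTrajectory σx σy _ _ (λ j → moves-someone (moveAt j))
              , pairTrajectory-fair σx σy _ _ x-moves-often y-moves-often
              , inj₂ (finishTime , holds⇒sat t finishTime (aligned ∧ᶠ bothEnded)
                                       (trans (at-positions finishTime (aligned ∧ᶠ bothEnded)) ends)
                     , λ j _ → holds⇒sat t j (aligned ∧ᶠ matching) (trans (at-positions j (aligned ∧ᶠ matching)) (aligned-matching j)))

      witnessed : Witnessed
      witnessed with first-false (λ j → sameLetterᵇ (σx j) (σy j)) (suc (Alignment.L W balanced))
      ... | inj₁ agree-to-L              = Agreeing.witnessed λ j j≤L → agree-to-L j (s≤s j≤L)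
      ... | inj₂ (q , differ , before) = differing q differ before

  construct : PCPSolvable P → kripke ⊨ pcpFormula
  construct ([] , I≢[] , _) = ⊥-elim (I≢[] refl)
  construct (i₀ ∷ rest , _ , solves) =
    reads i₀ rest , reads-trace i₀ rest , λ σy σy∈K → Witness.Against.witnessed i₀ rest solves (trace⇒run σy∈K)

empty-tile-solves : ∀ t → length (tileWord t) ≡ 0 → proj₁ t ++ [] ≡ proj₂ t ++ []
empty-tile-solves ([] , []) _ = refl

solvable-or-nonempty : ∀ P → PCPSolvable P ⊎ (∀ i → 0 < PCPKripke.len P i)
solvable-or-nonempty P with any? (λ i → PCPKripke.len P i ≟ 0)
... | yes (i , empty) = inj₁ (i ∷ [] , (λ ()) , empty-tile-solves (lookup P i) empty)
... | no ¬empty       = inj₂ nonempty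
  where
    nonempty : ∀ i → 0 < PCPKripke.len P i
    nonempty i with PCPKripke.len P i in len-i
    ... | zero  = ⊥-elim (¬empty (i , len-i))
    ... | suc _ = s≤s z≤n

pcpFormula-reduces : ∀ P → (∀ i → 0 < PCPKripke.len P i) → PCPKripke.kripke P ⊨ pcpFormula ⇔ PCPSolvable P
pcpFormula-reduces P nonempty = mk⇔ (Extraction.extract P nonempty) (Construction.construct P nonempty)

theorem5 : ((k : ℕ) (K : Kripke k) (φ : Formula k) → Closed φ → Dec (K ⊨ φ))
           → (P : List Tile) → Dec (PCPSolvable P)
theorem5 model-check P with solvable-or-nonempty P
... | inj₁ solvable = yes solvable
... | inj₂ nonempty =
  Dec.map (pcpFormula-reduces P nonempty) (model-check 5 (PCPKripke.kripke P) pcpFormula pcpFormula-closed)
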